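{- There exist finite connected graphs $G\subseteq H$ on the same vertex set such that $G$ is stackable but $H$ is strongly non-stackable.
   Context: Cup stacking on a finite connected graph: initially one cup on every vertex; a move takes all $r\ge1$ cups from a vertex $x$ onto a vertex $y\neq x$ that already carries at least one cup and satisfies $d(x,y)=r$ (shortest-path distance). A graph is $t$-stackable if some sequence of moves ends with all cups on $t$; stackable if it is $t$-stackable for every vertex $t$; strongly non-stackable if it is not $t$-stackable for any vertex $t$. -}

module Defs where

open import Data.Nat using (ℕ; zero; suc; _+_; _<_; _≤_)
open import Data.Fin using (Fin; _≟_)
open import Data.Bool using (Bool; true; false; T; if_then_else_)
open import Data.Product using (Σ; _×_; ∃)
open import Relation.Nullary using (¬_; does)
open import Relation.Binary.PropositionalEquality using (_≡_; _≢_)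
open import Relation.Binary.Construct.Closure.ReflexiveTransitive using (Star)

record Graph (n : ℕ) : Set where
  field
    adj   : Fin n → Fin n → Bool
    sym   : ∀ x y → adj x y ≡ adj y x
    irrefl : ∀ x → adj x x ≡ false
open Graph public

Edge : ∀ {n} → Graph n → Fin n → Fin n → Set
Edge G x y = T (adj G x y)

data Walk {n : ℕ} (G : Graph n) : Fin n → Fin n → ℕ → Set where
  here : ∀ {x} → Walk G x x zero
  step : ∀ {x y z k} → Edge G x y → Walk G y z k → Walk G x z (suc k)

Dist : ∀ {n} → Graph n → Fin n → Fin n → ℕ → Set
Dist G x y r = Walk G x y r × (∀ k → k < r → ¬ Walk G x y k)

Connected : ∀ {n} → Graph n → Set
Connected {n} G = ∀ (x y : Fin n) → ∃ λ k → Walk G x y k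

Subgraph : ∀ {n} → Graph n → Graph n → Set
Subgraph G H = ∀ x y → Edge G x y → Edge H x y

-- Configurations: number of cups on each vertex.
Config : ℕ → Set
Config n = Fin n → ℕ

moveCups : ∀ {n} → Config n → Fin n → Fin n → Config n
moveCups c x y z =
  if does (z ≟ x) then 0 else (if does (z ≟ y) then c y + c x else c z)

data Move {n : ℕ} (G : Graph n) : Config n → Config n → Set where
  move : ∀ {c} (x y : Fin n) →
         1 ≤ c x → x ≢ y → 1 ≤ c y → Dist G x y (c x) →
         Move G c (moveCups c x y)

initial : ∀ {n} → Config n
initial _ = 1

AllOn : ∀ {n} → Fin n → Config n → Set
AllOn {n} t c = ∀ z → c z ≡ (if does (z ≟ t) then n else 0)

Stackable-at : ∀ {n} → Graph n → Fin n → Set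
Stackable-at G t = ∃ λ c → Star (Move G) initial c × AllOn t c

Stackable : ∀ {n} → Graph n → Set
Stackable {n} G = ∀ (t : Fin n) → Stackable-at G t

StronglyNonStackable : ∀ {n} → Graph n → Set
StronglyNonStackable {n} G = ∀ (t : Fin n) → ¬ Stackable-at G t

{-# OPTIONS --safe #-}

-- H has diameter 2, so a stack of three or more cups off the target never moves again.
-- Let A be an independent set whose neighbours all lie in S, with |S| < |A| and t ∉ A ∪ S.
-- A single cup on A can only be cleared by pairing it with a single cup on S, and a move
-- that does not create a stack of three off t never decreases (singles on A) − (singles on S);
-- hence t cannot collect everything.  H consists of a clique 0,…,3 of hubs and three
-- independent sets A₁, A₂, A₃ joined to sets of hubs S₁, S₂, S₃ that meet pairwise (whence
-- diameter 2) but have no common point, so that every t avoids some Aᵢ ∪ Sᵢ.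
-- The subgraph G has diameter 6, which leaves enough room to stack on every vertex.
module Submission where

open import Defs
open import Data.Bool using (Bool; false; T)
open import Data.Bool.ListAction using (any)
open import Data.Bool.Properties as Bool using (T?)
open import Data.Fin using (Fin; toℕ; _≟_)
open import Data.Fin.Literals renaming (number to Fin-number)
open import Data.Fin.Properties using (all?; any?; toℕ<n)
open import Data.Fin.Subset using (Subset; inside; outside; _∈_; _∉_; _∩_; _∪_; ∣_∣; ⊥; ⁅_⁆)
open import Data.Fin.Subset.Properties
open import Data.List using (List; []; _∷_; _++_; foldr)
open import Data.Nat using (ℕ; zero; suc; _+_; _≤_; _<_; z≤n; s≤s; s≤s⁻¹; _≤?_; _<?_)
open import Data.Nat.Literals renaming (number to ℕ-number)
import Data.Nat.Properties as ℕ
open import Data.Product using (Σ; ∃; _×_; _,_; proj₁; proj₂)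
open import Data.Sum using (_⊎_; inj₁; inj₂)
open import Data.Unit using (⊤; tt)
open import Data.Vec using (Vec; []; _∷_; lookup; tabulate)
open import Data.Vec.Properties using (lookup∘tabulate; lookup⇒[]=; []=⇒lookup)
open import Function using (case_of_)
open import Relation.Binary.Construct.Closure.ReflexiveTransitive using (Star; ε; _◅_)
open import Relation.Binary.PropositionalEquality using (_≡_; _≢_; refl; trans; subst; cong) renaming (sym to ≡-sym)
open import Relation.Nullary using (¬_; Dec; yes; no; does; contradiction)
open import Relation.Nullary.Decidable using (_×-dec_; _→-dec_; ¬?; map′; from-yes; dec-true; dec-false)

private variable
  n : ℕ

-- Decision procedures

edge? : (G : Graph n) (x y : Fin n) → Dec (Edge G x y)
edge? G x y = T? (adj G x y)

walk? : (G : Graph n) (x y : Fin n) (k : ℕ) → Dec (Walk G x y k)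
walk? G x y zero = map′ (λ { refl → here }) (λ { here → refl }) (x ≟ y)
walk? G x y (suc k) =
  map′ (λ { (z , e , w) → step e w }) (λ { (step e w) → _ , e , w })
       (any? λ z → edge? G x z ×-dec walk? G z y k)

dist? : (G : Graph n) (x y : Fin n) (r : ℕ) → Dec (Dist G x y r)
dist? G x y r =
  walk? G x y r ×-dec
  map′ (λ f k → f {k}) (λ f {k} → f k) (ℕ.allUpTo? (λ k → ¬? (walk? G x y k)) r)

allOn? : (t : Fin n) (c : Config n) → Dec (AllOn t c)
allOn? t c = all? λ z → c z ℕ.≟ _

-- A strategy as plain data, so that its legality and its final configuration can be computed.
Play : ℕ → Set
Play n = List (Fin n × Fin n)

pattern _⇒_ x y = x , y
infix 6 _⇒_

result : Config n → Play n → Config n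
result c []             = c
result c ((x ⇒ y) ∷ ms) = result (moveCups c x y) ms

Legal : Graph n → Config n → Play n → Set
Legal G c []             = ⊤
Legal G c ((x ⇒ y) ∷ ms) =
  (1 ≤ c x × x ≢ y × 1 ≤ c y × Dist G x y (c x)) × Legal G (moveCups c x y) ms

legal? : (G : Graph n) (c : Config n) (ms : Play n) → Dec (Legal G c ms)
legal? G c []             = yes tt
legal? G c ((x ⇒ y) ∷ ms) =
  (1 ≤? c x ×-dec ¬? (x ≟ y) ×-dec 1 ≤? c y ×-dec dist? G x y (c x))
  ×-dec legal? G (moveCups c x y) ms

legal⇒moves : (G : Graph n) (c : Config n) (ms : Play n) → Legal G c ms → Star (Move G) c (result c ms)
legal⇒moves G c []             _                     = ε
legal⇒moves G c ((x ⇒ y) ∷ ms) ((p , q , r , d) , l) = move x y p q r d ◅ legal⇒moves G _ ms l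

-- Cardinalities of subsets

∣p∪q∣≤∣p∣+∣q∣ : (p q : Subset n) → ∣ p ∪ q ∣ ≤ ∣ p ∣ + ∣ q ∣
∣p∪q∣≤∣p∣+∣q∣ []            []            = z≤n
∣p∪q∣≤∣p∣+∣q∣ (outside ∷ p) (outside ∷ q) = ∣p∪q∣≤∣p∣+∣q∣ p q
∣p∪q∣≤∣p∣+∣q∣ (outside ∷ p) (inside  ∷ q) =
  subst (suc ∣ p ∪ q ∣ ≤_) (≡-sym (ℕ.+-suc ∣ p ∣ ∣ q ∣)) (s≤s (∣p∪q∣≤∣p∣+∣q∣ p q))
∣p∪q∣≤∣p∣+∣q∣ (inside  ∷ p) (q₀      ∷ q) =
  s≤s (ℕ.≤-trans (∣p∪q∣≤∣p∣+∣q∣ p q) (ℕ.+-monoʳ-≤ ∣ p ∣ (∣p∣≤∣x∷p∣ q₀ q)))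

-- Here `p` is contained in `⁅ x ⁆ ∪ q`. It serves to bound the loss when a move can remove only one
-- vertex from a set.
∣p∣≤1+∣q∣ : {p q : Subset n} (x : Fin n) → (∀ {v} → v ∈ p → v ≢ x → v ∈ q) → ∣ p ∣ ≤ suc ∣ q ∣
∣p∣≤1+∣q∣ {p = p} {q} x p-x⊆q = begin
  ∣ p ∣               ≤⟨ p⊆q⇒∣p∣≤∣q∣ p⊆x∪q ⟩
  ∣ ⁅ x ⁆ ∪ q ∣       ≤⟨ ∣p∪q∣≤∣p∣+∣q∣ ⁅ x ⁆ q ⟩
  ∣ ⁅ x ⁆ ∣ + ∣ q ∣   ≡⟨ cong (_+ ∣ q ∣) (∣⁅x⁆∣≡1 x) ⟩
  suc ∣ q ∣           ∎
  where
  open ℕ.≤-Reasoning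
  p⊆x∪q : ∀ {v} → v ∈ p → v ∈ ⁅ x ⁆ ∪ q
  p⊆x∪q {v} v∈p with v ≟ x
  ... | yes refl = x∈p∪q⁺ (inj₁ (x∈⁅x⁆ x))
  ... | no  v≢x  = x∈p∪q⁺ (inj₂ (p-x⊆q v∈p v≢x))

-- Moves

moveCups-source : (c : Config n) (x y : Fin n) → moveCups c x y x ≡ 0
moveCups-source c x y rewrite dec-true (x ≟ x) refl = refl

moveCups-target : (c : Config n) {x y : Fin n} → x ≢ y → moveCups c x y y ≡ c y + c x
moveCups-target c {x} {y} x≢y
  rewrite dec-false (y ≟ x) (λ e → x≢y (≡-sym e)) | dec-true (y ≟ y) refl = refl

moveCups-other : (c : Config n) {x y z : Fin n} → z ≢ x → z ≢ y → moveCups c x y z ≡ c z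
moveCups-other c {x} {y} {z} z≢x z≢y rewrite dec-false (z ≟ x) z≢x | dec-false (z ≟ y) z≢y = refl

moveCups-grows : (c : Config n) {x y z : Fin n} → x ≢ y → z ≢ x → c z ≤ moveCups c x y z
moveCups-grows c {x} {y} {z} x≢y z≢x = case z ≟ y of λ where
  (yes refl) → subst (c z ≤_) (≡-sym (moveCups-target c x≢y)) (ℕ.m≤m+n (c z) (c x))
  (no  z≢y)  → ℕ.≤-reflexive (≡-sym (moveCups-other c z≢x z≢y))

-- Single cups and deficient sets

ones : Config n → Subset n
ones c = tabulate λ v → does (c v ℕ.≟ 1)

∈-ones⁺ : (c : Config n) {v : Fin n} → c v ≡ 1 → v ∈ ones c
∈-ones⁺ c {v} cv≡1 = lookup⇒[]= v _ (trans (lookup∘tabulate _ v) (dec-true (c v ℕ.≟ 1) cv≡1))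

∈-ones⁻ : (c : Config n) {v : Fin n} → v ∈ ones c → c v ≡ 1
∈-ones⁻ c {v} v∈ = case c v ℕ.≟ 1 of λ where
  (yes cv≡1) → cv≡1
  (no  cv≢1) → contradiction
    (trans (≡-sym (trans (lookup∘tabulate _ v) (dec-false (c v ℕ.≟ 1) cv≢1))) ([]=⇒lookup v∈)) λ ()

-- A violation of Hall's condition away from `t`: the neighbourhood of `A` lies in the smaller set
-- `S`. Independence of `A` follows from `neighbours` and `disjoint`.
record Deficient (H : Graph n) (t : Fin n) (A S : Subset n) : Set where
  field
    t∉A        : t ∉ A
    t∉S        : t ∉ S
    disjoint   : ∀ x → x ∈ A → x ∉ S
    neighbours : ∀ x y → x ∈ A → Edge H x y → y ∈ S
    deficient  : ∣ S ∣ < ∣ A ∣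

deficient? : (H : Graph n) (t : Fin n) (A S : Subset n) → Dec (Deficient H t A S)
deficient? H t A S =
  map′ (λ (a , b , c , d , e) → record { t∉A = a ; t∉S = b ; disjoint = c ; neighbours = d ; deficient = e })
       (λ D → let open Deficient D in t∉A , t∉S , disjoint , neighbours , deficient)
       (¬? (t ∈? A) ×-dec ¬? (t ∈? S) ×-dec all? (λ x → x ∈? A →-dec ¬? (x ∈? S))
        ×-dec all? (λ x → all? λ y → x ∈? A →-dec edge? H x y →-dec y ∈? S) ×-dec ∣ S ∣ <? ∣ A ∣)

Dist-1⇒Edge : {G : Graph n} {x y : Fin n} → Dist G x y 1 → Edge G x y
Dist-1⇒Edge (step e here , _) = e

-- The invariant that obstructs a fixed target

module Obstruction {n} {H : Graph n} (dist≤2 : ∀ {x y r} → Dist H x y r → r ≤ 2)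
                   {t : Fin n} {A S : Subset n} (D : Deficient H t A S) where
  open Deficient D

  -- The invariant: an immovable heap off `t`, or a surplus of single cups on `A` over those on `S`.
  Stuck : Config n → Set
  Stuck c = (∃ λ v → v ≢ t × 3 ≤ c v) ⊎ ∣ S ∩ ones c ∣ < ∣ A ∩ ones c ∣

  private
    ∈⇒≢t : ∀ {v P} → t ∉ P → v ∈ P → v ≢ t
    ∈⇒≢t t∉P v∈P refl = t∉P v∈P

  stuck-initial : Stuck initial
  stuck-initial = inj₂ (begin-strict
    ∣ S ∩ ones initial ∣  ≤⟨ ∣p∩q∣≤∣p∣ S _ ⟩
    ∣ S ∣                 <⟨ deficient ⟩
    ∣ A ∣                 ≤⟨ p⊆q⇒∣p∣≤∣q∣ {p = A} (λ v∈A → x∈p∩q⁺ (v∈A , ∈-ones⁺ initial refl)) ⟩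
    ∣ A ∩ ones initial ∣  ∎)
    where open ℕ.≤-Reasoning

  -- Off `t` no cup remains, which rules out a heap there; since `t ∉ A`, it also leaves `A` without
  -- single cups, so there is no surplus.
  allOn⇒¬stuck : ∀ {c} → AllOn t c → ¬ Stuck c
  allOn⇒¬stuck {c} on-t = λ where
      (inj₁ (v , v≢t , 3≤cv)) → contradiction (subst (3 ≤_) (empty v≢t) 3≤cv) λ ()
      (inj₂ s<a) → contradiction (ℕ.<-≤-trans s<a a≤0) λ ()
    where
    empty : ∀ {v} → v ≢ t → c v ≡ 0
    empty {v} v≢t with on-t v
    ... | eq rewrite dec-false (v ≟ t) v≢t = eq
    a≤0 : ∣ A ∩ ones c ∣ ≤ 0
    a≤0 = subst (∣ A ∩ ones c ∣ ≤_) (∣⊥∣≡0 n) (p⊆q⇒∣p∣≤∣q∣ {p = A ∩ ones c} {⊥} λ v∈ →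
      let v∈A , v∈ones = x∈p∩q⁻ A _ v∈
      in contradiction (trans (≡-sym (∈-ones⁻ c v∈ones)) (empty (∈⇒≢t t∉A v∈A))) λ ())

  module _ {c : Config n} {x y : Fin n} (1≤cx : 1 ≤ c x) (x≢y : x ≢ y) (1≤cy : 1 ≤ c y)
           (d : Dist H x y (c x)) where
    private
      c′ : Config n
      c′ = moveCups c x y

    ones-kept : ∀ {v} → v ≢ x → v ≢ y → v ∈ ones c → v ∈ ones c′
    ones-kept v≢x v≢y v∈ = ∈-ones⁺ c′ (trans (moveCups-other c v≢x v≢y) (∈-ones⁻ c v∈))

    source-lost : x ∉ ones c′
    source-lost x∈ = contradiction (trans (≡-sym (moveCups-source c x y)) (∈-ones⁻ c′ x∈)) λ ()

    target-lost : y ∉ ones c′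
    target-lost y∈ = contradiction
      (subst (2 ≤_) (trans (≡-sym (moveCups-target c x≢y)) (∈-ones⁻ c′ y∈)) (ℕ.+-mono-≤ 1≤cy 1≤cx))
      λ { (s≤s ()) }

    -- A move leaves 0 cups on its source and at least 2 on its target, so it never creates a single
    -- cup.
    ones-shrink : ∀ {v} → v ∈ ones c′ → v ∈ ones c
    ones-shrink {v} v∈ with v ≟ x | v ≟ y
    ... | yes refl | _        = contradiction v∈ source-lost
    ... | no  _    | yes refl = contradiction v∈ target-lost
    ... | no  v≢x  | no  v≢y  = ∈-ones⁺ c (trans (≡-sym (moveCups-other c v≢x v≢y)) (∈-ones⁻ c′ v∈))

    -- The count on `A` does not drop, and the count on `S` cannot rise.
    stuck-untouched : (∀ {v} → v ∈ A → v ∈ ones c → v ≢ x × v ≢ y) →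
                      ∣ S ∩ ones c ∣ < ∣ A ∩ ones c ∣ → Stuck c′
    stuck-untouched avoid s<a = inj₂ (begin-strict
      ∣ S ∩ ones c′ ∣  ≤⟨ p⊆q⇒∣p∣≤∣q∣ (λ v∈ → let v∈S , v∈′ = x∈p∩q⁻ S _ v∈ in x∈p∩q⁺ (v∈S , ones-shrink v∈′)) ⟩
      ∣ S ∩ ones c ∣   <⟨ s<a ⟩
      ∣ A ∩ ones c ∣   ≤⟨ p⊆q⇒∣p∣≤∣q∣ (λ v∈ →
                            let v∈A , v∈′ = x∈p∩q⁻ A _ v∈ ; v≢x , v≢y = avoid v∈A v∈′
                            in x∈p∩q⁺ (v∈A , ones-kept v≢x v≢y v∈′)) ⟩
      ∣ A ∩ ones c′ ∣  ∎)
      where open ℕ.≤-Reasoning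

    -- The single cup at `u` is lost from `S`, while `w` is the only vertex that `A` can lose. The
    -- surplus therefore does not decrease.
    stuck-paired : ∀ {u w} → u ∈ S → u ∈ ones c → u ∉ ones c′ →
                   (∀ {v} → v ∈ A → v ≢ w → v ≢ x × v ≢ y) →
                   ∣ S ∩ ones c ∣ < ∣ A ∩ ones c ∣ → Stuck c′
    stuck-paired {u} {w} u∈S u∈ u∉ avoid s<a = inj₂ (s≤s⁻¹ (begin-strict
      suc ∣ S ∩ ones c′ ∣  ≤⟨ p⊂q⇒∣p∣<∣q∣
                               ((λ v∈ → let v∈S , v∈′ = x∈p∩q⁻ S _ v∈ in x∈p∩q⁺ (v∈S , ones-shrink v∈′))
                               , u , x∈p∩q⁺ (u∈S , u∈) , λ u∈′ → u∉ (proj₂ (x∈p∩q⁻ S _ u∈′))) ⟩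
      ∣ S ∩ ones c ∣       <⟨ s<a ⟩
      ∣ A ∩ ones c ∣       ≤⟨ ∣p∣≤1+∣q∣ w (λ v∈ v≢w →
                                let v∈A , v∈′ = x∈p∩q⁻ A _ v∈ ; v≢x , v≢y = avoid v∈A v≢w
                                in x∈p∩q⁺ (v∈A , ones-kept v≢x v≢y v∈′)) ⟩
      suc ∣ A ∩ ones c′ ∣  ∎))
      where open ℕ.≤-Reasoning

    stuck-heap : y ≢ t → 3 ≤ c y + c x → Stuck c′
    stuck-heap y≢t 3≤ = inj₁ (y , y≢t , subst (3 ≤_) (≡-sym (moveCups-target c x≢y)) 3≤)

    c≡1⊎c≥2 : ∀ {v} → 1 ≤ c v → c v ≡ 1 ⊎ 2 ≤ c v
    c≡1⊎c≥2 {v} 1≤cv with ℕ.m≤n⇒m<n∨m≡n 1≤cv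
    ... | inj₁ 2≤ = inj₂ 2≤
    ... | inj₂ e  = inj₁ (≡-sym e)

    stuck-preserved : Stuck c → Stuck c′
    stuck-preserved (inj₁ (v , v≢t , 3≤cv)) with v ≟ x
    -- Moving a heap of three or more would need a vertex at distance at least 3.
    ... | yes refl = contradiction (ℕ.≤-trans 3≤cv (dist≤2 d)) λ { (s≤s (s≤s ())) }
    ... | no  v≢x  = inj₁ (v , v≢t , ℕ.≤-trans 3≤cv (moveCups-grows c x≢y v≢x))
    stuck-preserved (inj₂ s<a) with c≡1⊎c≥2 1≤cx
    ... | inj₂ 2≤cx with y ≟ t
    ...   | no  y≢t  = stuck-heap y≢t (ℕ.+-mono-≤ 1≤cy 2≤cx)
    -- The source holds at least two cups and the target `t` is outside `A`, so no single cup of `A`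
    -- is involved.
    ...   | yes refl = stuck-untouched (λ v∈A v∈ →
              (λ { refl → contradiction (subst (2 ≤_) (∈-ones⁻ c v∈) 2≤cx) λ { (s≤s ()) } })
              , ∈⇒≢t t∉A v∈A) s<a
    stuck-preserved (inj₂ s<a) | inj₁ cx≡1
      -- A single cup travels along an edge, so a move that touches `A` has its other end in `S`.
      with e ← Dist-1⇒Edge (subst (Dist H x y) cx≡1 d) | x ∈? A | y ∈? A
    ... | no  x∉A | no  y∉A =
      stuck-untouched (λ v∈A _ → (λ { refl → x∉A v∈A }) , (λ { refl → y∉A v∈A })) s<a
    ... | yes x∈A | _ with y∈S ← neighbours x y x∈A e | c≡1⊎c≥2 1≤cy
    -- The target in `S` already holds two cups and differs from `t`, so a heap of three arises.
    ...   | inj₂ 2≤cy = stuck-heap (∈⇒≢t t∉S y∈S) (ℕ.+-mono-≤ 2≤cy 1≤cx)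
    ...   | inj₁ cy≡1 = stuck-paired y∈S (∈-ones⁺ c cy≡1) target-lost
              (λ v∈A v≢x → v≢x , λ { refl → disjoint _ v∈A y∈S }) s<a
    stuck-preserved (inj₂ s<a) | inj₁ cx≡1
        -- The single cup spent on `S` is now the source. `y` may hold more than one cup, as only an
        -- upper bound on the loss from `A` is needed.
        | no  x∉A | yes y∈A = stuck-paired x∈S (∈-ones⁺ c cx≡1) source-lost
              (λ v∈A v≢y → (λ { refl → x∉A v∈A }) , v≢y) s<a
      where x∈S = neighbours y x y∈A (subst T (sym H x y) e)

  stuck-moves : ∀ {c c′} → Star (Move H) c c′ → Stuck c → Stuck c′
  stuck-moves ε st = st
  stuck-moves (move x y p q r d ◅ ms) st = stuck-moves ms (stuck-preserved p q r d st)

  ¬stackable-at : ¬ Stackable-at H t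
  ¬stackable-at (c , ms , on-t) = allOn⇒¬stuck on-t (stuck-moves ms stuck-initial)

-- The two graphs

open import Agda.Builtin.FromNat using (Number; fromNat)

instance
  ℕ-literals : Number ℕ
  ℕ-literals = ℕ-number
  Fin14-literals : Number (Fin 14)
  Fin14-literals = Fin-number 14

Neighbourhoods : Set
Neighbourhoods = Vec (List (Fin 14)) 14

joined : Neighbourhoods → Fin 14 → Fin 14 → Bool
joined N x y = any (λ z → does (y ≟ z)) (lookup N x)

Symmetric Irreflexive : Neighbourhoods → Set
Symmetric   N = ∀ x y → joined N x y ≡ joined N y x
Irreflexive N = ∀ x → joined N x x ≡ false

symmetric? : ∀ N → Dec (Symmetric N)
symmetric? N = all? λ x → all? λ y → joined N x y Bool.≟ joined N y x

irreflexive? : ∀ N → Dec (Irreflexive N)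
irreflexive? N = all? λ x → joined N x x Bool.≟ false

-- Each `Aᵢ` exceeds `Sᵢ` by one vertex. The shared hubs are 1 for `S₁` and `S₂`, 0 for `S₁` and
-- `S₃`, 2 for `S₂` and `S₃`.
A₁ S₁ A₂ S₂ A₃ S₃ : List (Fin 14)
A₁ = 4 ∷ 5 ∷ 6 ∷ 7 ∷ []
S₁ = 0 ∷ 1 ∷ 3 ∷ []
A₂ = 8 ∷ 9 ∷ 10 ∷ []
S₂ = 1 ∷ 2 ∷ []
A₃ = 11 ∷ 12 ∷ 13 ∷ []
S₃ = 0 ∷ 2 ∷ []

-- Row `v` lists the neighbours of `v`. `N-G` omits the clique on the hubs and keeps 15 of the 24
-- edges between hubs and the `Aᵢ`.
N-G N-H : Neighbourhoods
N-G =
    (4 ∷ 7 ∷ 11 ∷ 13 ∷ [])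
  ∷ (5 ∷ 6 ∷ 8 ∷ 9 ∷ 10 ∷ [])
  ∷ (8 ∷ 12 ∷ 13 ∷ [])
  ∷ (5 ∷ 6 ∷ 7 ∷ [])
  ∷ (0 ∷ []) ∷ (1 ∷ 3 ∷ []) ∷ (1 ∷ 3 ∷ []) ∷ (0 ∷ 3 ∷ [])
  ∷ (1 ∷ 2 ∷ []) ∷ (1 ∷ []) ∷ (1 ∷ [])
  ∷ (0 ∷ []) ∷ (2 ∷ []) ∷ (0 ∷ 2 ∷ [])
  ∷ []
N-H =
    (1 ∷ 2 ∷ 3 ∷ A₁ ++ A₃)
  ∷ (0 ∷ 2 ∷ 3 ∷ A₁ ++ A₂)
  ∷ (0 ∷ 1 ∷ 3 ∷ A₂ ++ A₃)
  ∷ (0 ∷ 1 ∷ 2 ∷ A₁)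
  ∷ S₁ ∷ S₁ ∷ S₁ ∷ S₁
  ∷ S₂ ∷ S₂ ∷ S₂
  ∷ S₃ ∷ S₃ ∷ S₃
  ∷ []

G H : Graph 14
G = record { adj = joined N-G ; sym = from-yes (symmetric? N-G) ; irrefl = from-yes (irreflexive? N-G) }
H = record { adj = joined N-H ; sym = from-yes (symmetric? N-H) ; irrefl = from-yes (irreflexive? N-H) }

-- Abstract, since unification would otherwise normalise these decision proofs.
abstract
  G⊆H : Subgraph G H
  G⊆H = from-yes (all? λ x → all? λ y → edge? G x y →-dec edge? H x y)

  -- The bound 6 on the walk length makes connectedness a finite check.
  G-diameter : ∀ x y → ∃ λ (k : Fin 7) → Walk G x y (toℕ k)
  G-diameter = from-yes (all? λ x → all? λ y → any? λ (k : Fin 7) → walk? G x y (toℕ k))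

G-connected : Connected G
G-connected x y = let k , w = G-diameter x y in toℕ k , w

abstract
  H-diameter : ∀ x y → ∃ λ (k : Fin 3) → Walk H x y (toℕ k)
  H-diameter = from-yes (all? λ x → all? λ y → any? λ (k : Fin 3) → walk? H x y (toℕ k))

H-connected : Connected H
H-connected x y = let k , w = H-diameter x y in toℕ k , w

-- If `r` exceeded 2, the walk from `H-diameter` would be shorter than the distance.
H-dist≤2 : ∀ {x y r} → Dist H x y r → r ≤ 2
H-dist≤2 {x} {y} (_ , shortest) = ℕ.≮⇒≥ λ 2<r →
  let k , w = H-diameter x y in shortest (toℕ k) (ℕ.<-≤-trans (toℕ<n k) 2<r) w

-- The entry at index t collects all cups on t; found by computer search.
plays : Vec (Play 14) 14
plays =
    (8 ⇒ 1 ∷ 9 ⇒ 1 ∷ 10 ⇒ 1 ∷ 1 ⇒ 0 ∷ 12 ⇒ 2 ∷ 2 ⇒ 0 ∷ 3 ⇒ 6 ∷ 6 ⇒ 5 ∷ 5 ⇒ 0 ∷ 4 ⇒ 0 ∷ 7 ⇒ 0 ∷ 11 ⇒ 0 ∷ 13 ⇒ 0 ∷ [])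
  ∷ (7 ⇒ 0 ∷ 11 ⇒ 0 ∷ 13 ⇒ 0 ∷ 0 ⇒ 1 ∷ 12 ⇒ 2 ∷ 2 ⇒ 1 ∷ 5 ⇒ 3 ∷ 6 ⇒ 3 ∷ 3 ⇒ 8 ∷ 8 ⇒ 4 ∷ 4 ⇒ 1 ∷ 9 ⇒ 1 ∷ 10 ⇒ 1 ∷ [])
  ∷ (0 ⇒ 11 ∷ 11 ⇒ 4 ∷ 4 ⇒ 2 ∷ 1 ⇒ 10 ∷ 10 ⇒ 9 ∷ 9 ⇒ 2 ∷ 5 ⇒ 3 ∷ 6 ⇒ 3 ∷ 7 ⇒ 3 ∷ 3 ⇒ 2 ∷ 8 ⇒ 2 ∷ 12 ⇒ 2 ∷ 13 ⇒ 2 ∷ [])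
  ∷ (11 ⇒ 0 ∷ 0 ⇒ 3 ∷ 1 ⇒ 10 ∷ 10 ⇒ 9 ∷ 9 ⇒ 3 ∷ 8 ⇒ 2 ∷ 13 ⇒ 2 ∷ 2 ⇒ 4 ∷ 4 ⇒ 12 ∷ 12 ⇒ 3 ∷ 5 ⇒ 3 ∷ 6 ⇒ 3 ∷ 7 ⇒ 3 ∷ [])
  ∷ (11 ⇒ 0 ∷ 13 ⇒ 0 ∷ 0 ⇒ 5 ∷ 5 ⇒ 4 ∷ 12 ⇒ 2 ∷ 2 ⇒ 1 ∷ 9 ⇒ 1 ∷ 10 ⇒ 1 ∷ 1 ⇒ 4 ∷ 6 ⇒ 3 ∷ 7 ⇒ 3 ∷ 3 ⇒ 8 ∷ 8 ⇒ 4 ∷ [])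
  ∷ (7 ⇒ 0 ∷ 11 ⇒ 0 ∷ 0 ⇒ 5 ∷ 9 ⇒ 1 ∷ 10 ⇒ 1 ∷ 1 ⇒ 12 ∷ 12 ⇒ 5 ∷ 8 ⇒ 2 ∷ 13 ⇒ 2 ∷ 2 ⇒ 4 ∷ 4 ⇒ 5 ∷ 3 ⇒ 6 ∷ 6 ⇒ 5 ∷ [])
  ∷ (7 ⇒ 0 ∷ 11 ⇒ 0 ∷ 0 ⇒ 6 ∷ 9 ⇒ 1 ∷ 10 ⇒ 1 ∷ 1 ⇒ 12 ∷ 12 ⇒ 6 ∷ 8 ⇒ 2 ∷ 13 ⇒ 2 ∷ 2 ⇒ 4 ∷ 4 ⇒ 6 ∷ 3 ⇒ 5 ∷ 5 ⇒ 6 ∷ [])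
  ∷ (4 ⇒ 0 ∷ 11 ⇒ 0 ∷ 0 ⇒ 8 ∷ 8 ⇒ 7 ∷ 5 ⇒ 1 ∷ 9 ⇒ 1 ∷ 1 ⇒ 7 ∷ 12 ⇒ 2 ∷ 13 ⇒ 2 ∷ 2 ⇒ 10 ∷ 10 ⇒ 7 ∷ 3 ⇒ 6 ∷ 6 ⇒ 7 ∷ [])
  ∷ (11 ⇒ 0 ∷ 13 ⇒ 0 ∷ 0 ⇒ 8 ∷ 9 ⇒ 1 ∷ 10 ⇒ 1 ∷ 1 ⇒ 7 ∷ 7 ⇒ 8 ∷ 2 ⇒ 12 ∷ 12 ⇒ 8 ∷ 5 ⇒ 3 ∷ 6 ⇒ 3 ∷ 3 ⇒ 4 ∷ 4 ⇒ 8 ∷ [])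
  ∷ (12 ⇒ 2 ∷ 2 ⇒ 0 ∷ 4 ⇒ 0 ∷ 11 ⇒ 0 ∷ 0 ⇒ 9 ∷ 8 ⇒ 1 ∷ 10 ⇒ 1 ∷ 1 ⇒ 7 ∷ 7 ⇒ 9 ∷ 5 ⇒ 3 ∷ 6 ⇒ 3 ∷ 3 ⇒ 13 ∷ 13 ⇒ 9 ∷ [])
  ∷ (12 ⇒ 2 ∷ 2 ⇒ 0 ∷ 4 ⇒ 0 ∷ 11 ⇒ 0 ∷ 0 ⇒ 10 ∷ 8 ⇒ 1 ∷ 9 ⇒ 1 ∷ 1 ⇒ 7 ∷ 7 ⇒ 10 ∷ 5 ⇒ 3 ∷ 6 ⇒ 3 ∷ 3 ⇒ 13 ∷ 13 ⇒ 10 ∷ [])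
  ∷ (0 ⇒ 4 ∷ 4 ⇒ 11 ∷ 5 ⇒ 1 ∷ 8 ⇒ 1 ∷ 9 ⇒ 1 ∷ 10 ⇒ 1 ∷ 1 ⇒ 11 ∷ 12 ⇒ 2 ∷ 13 ⇒ 2 ∷ 2 ⇒ 11 ∷ 6 ⇒ 3 ∷ 7 ⇒ 3 ∷ 3 ⇒ 11 ∷ [])
  ∷ (11 ⇒ 0 ∷ 13 ⇒ 0 ∷ 0 ⇒ 12 ∷ 9 ⇒ 1 ∷ 10 ⇒ 1 ∷ 1 ⇒ 7 ∷ 7 ⇒ 12 ∷ 2 ⇒ 8 ∷ 8 ⇒ 12 ∷ 5 ⇒ 3 ∷ 6 ⇒ 3 ∷ 3 ⇒ 4 ∷ 4 ⇒ 12 ∷ [])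
  ∷ (4 ⇒ 0 ∷ 11 ⇒ 0 ∷ 0 ⇒ 5 ∷ 5 ⇒ 13 ∷ 8 ⇒ 1 ∷ 9 ⇒ 1 ∷ 1 ⇒ 13 ∷ 2 ⇒ 12 ∷ 12 ⇒ 13 ∷ 6 ⇒ 3 ∷ 7 ⇒ 3 ∷ 3 ⇒ 10 ∷ 10 ⇒ 13 ∷ [])
  ∷ []

abstract
  G-plays : ∀ t → Legal G initial (lookup plays t) × AllOn t (result initial (lookup plays t))
  G-plays = from-yes (all? λ t → legal? G initial (lookup plays t) ×-dec allOn? t (result initial (lookup plays t)))

G-stackable : Stackable G
G-stackable t =
  let legal , on-t = G-plays t
  in result initial (lookup plays t) , legal⇒moves G initial (lookup plays t) legal , on-t

-- Strong non-stackability of `H`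

fromList : List (Fin 14) → Subset 14
fromList = foldr (λ v p → ⁅ v ⁆ ∪ p) ⊥

-- Hubs 0, 1 and 2 each lie in two of the `Sᵢ`, which forces the third pair. Hub 3 lies only in
-- `S₁`, and a target in `Aᵢ` takes the cyclically next pair.
obstacle : Fin 14 → List (Fin 14) × List (Fin 14)
obstacle = lookup
  ( (A₂ , S₂) ∷ (A₃ , S₃) ∷ (A₁ , S₁) ∷ (A₂ , S₂)
  ∷ (A₂ , S₂) ∷ (A₂ , S₂) ∷ (A₂ , S₂) ∷ (A₂ , S₂)
  ∷ (A₃ , S₃) ∷ (A₃ , S₃) ∷ (A₃ , S₃)
  ∷ (A₁ , S₁) ∷ (A₁ , S₁) ∷ (A₁ , S₁) ∷ [])

abstract
  H-deficient : ∀ t → Deficient H t (fromList (proj₁ (obstacle t))) (fromList (proj₂ (obstacle t)))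
  H-deficient = from-yes (all? λ t → deficient? H t (fromList (proj₁ (obstacle t))) (fromList (proj₂ (obstacle t))))

H-stronglyNonStackable : StronglyNonStackable H
H-stronglyNonStackable t = Obstruction.¬stackable-at H-dist≤2 (H-deficient t)

theorem5p4 : Σ ℕ λ n → 0 < n × Σ (Graph n) λ G → Σ (Graph n) λ H →
    Connected G × Connected H × Subgraph G H ×
    Stackable G × StronglyNonStackable H
theorem5p4 = 14 , s≤s z≤n , G , H , G-connected , H-connected , G⊆H , G-stackable , H-stronglyNonStackable
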